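{- Let $P(7,1)$ be the graph with vertex set $\{u_0,\dots,u_6,v_0,\dots,v_6\}$ and edges $u_iu_{i+1}$, $v_iv_{i+1}$, $u_iv_i$ ($i=0,\dots,6$, indices mod $7$). Up to switching isomorphism there are exactly $27$ different signed graphs on $P(7,1)$; i.e., the set of all signatures $\Sigma\subseteq E(P(7,1))$ falls into exactly $27$ classes under switching isomorphism.
   Context: A signature of a graph $G$ is a subset $\Sigma\subseteq E(G)$ (the negative edges). Resigning at a vertex $v$ replaces $\Sigma$ by its symmetric difference with the set of edges incident with $v$; two signatures are switching equivalent if one is obtained from the other by a sequence of resignings. Two signatures $\Sigma_1,\Sigma_2$ of $G$ are switching isomorphic if there is an automorphism $\psi$ of $G$ such that $\psi(\Sigma_1)=\{\psi(x)\psi(y):xy\in\Sigma_1\}$ is switching equivalent to $\Sigma_2$. -}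

module Defs where

open import Data.Bool using (Bool; true; false; _xor_; _∨_)
open import Data.Fin using (Fin; zero; suc)
open import Data.Fin.Properties using () renaming (_≟_ to _≟ᶠ_)
open import Data.Product using (Σ; ∃; _×_; _,_; proj₁; proj₂)
open import Data.Sum using (_⊎_)
open import Relation.Binary.PropositionalEquality using (_≡_)
open import Relation.Nullary.Decidable using (⌊_⌋)
open import Relation.Binary.Construct.Closure.ReflexiveTransitive using (Star)
open import Function.Bundles using (_⇔_; _↔_; Inverse)

next : Fin 7 → Fin 7
next zero = suc zero
next (suc zero) = suc (suc zero)
next (suc (suc zero)) = suc (suc (suc zero))
next (suc (suc (suc zero))) = suc (suc (suc (suc zero)))
next (suc (suc (suc (suc zero)))) = suc (suc (suc (suc (suc zero))))
next (suc (suc (suc (suc (suc zero))))) = suc (suc (suc (suc (suc (suc zero)))))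
next (suc (suc (suc (suc (suc (suc zero)))))) = zero

data Vertex : Set where
  u : Fin 7 → Vertex
  v : Fin 7 → Vertex

data Edge : Set where
  uu : Fin 7 → Edge
  vv : Fin 7 → Edge
  uv : Fin 7 → Edge

ends : Edge → Vertex × Vertex
ends (uu i) = u i , u (next i)
ends (vv i) = v i , v (next i)
ends (uv i) = u i , v i

Joins : Edge → Vertex → Vertex → Set
Joins e x y = (ends e ≡ (x , y)) ⊎ (ends e ≡ (y , x))

Adj : Vertex → Vertex → Set
Adj x y = ∃ λ e → Joins e x y

record Automorphism : Set where
  field
    perm     : Vertex ↔ Vertex
    preserve : ∀ x y → Adj x y ⇔ Adj (Inverse.to perm x) (Inverse.to perm y)

-- A signature is a subset of E(P(7,1)) (characteristic function; true = negative).
Signature : Set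
Signature = Edge → Bool

_≟ᵥ_ : Vertex → Vertex → Bool
u i ≟ᵥ u j = ⌊ i ≟ᶠ j ⌋
v i ≟ᵥ v j = ⌊ i ≟ᶠ j ⌋
u _ ≟ᵥ v _ = false
v _ ≟ᵥ u _ = false

incident : Vertex → Edge → Bool
incident w e = (w ≟ᵥ proj₁ (ends e)) ∨ (w ≟ᵥ proj₂ (ends e))

resign : Vertex → Signature → Signature
resign w σ e = σ e xor incident w e

ResignStep : Signature → Signature → Set
ResignStep σ τ = ∃ λ w → ∀ e → τ e ≡ resign w σ e

SwitchEq : Signature → Signature → Set
SwitchEq = Star ResignStep

InImage : Automorphism → Signature → Edge → Set
InImage ψ σ e' = ∃ λ e → (σ e ≡ true) ×
  Joins e' (Inverse.to (Automorphism.perm ψ) (proj₁ (ends e)))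
           (Inverse.to (Automorphism.perm ψ) (proj₂ (ends e)))

SwitchIso : Signature → Signature → Set
SwitchIso σ₁ σ₂ = Σ Automorphism λ ψ → ∃ λ τ →
  (∀ e → (τ e ≡ true) ⇔ InImage ψ σ₁ e) × SwitchEq τ σ₂

{-# OPTIONS --safe #-}
module Submission where

-- The sign products of the seven quadrilaterals and of the u-cycle form a complete switching
-- invariant with 2⁸ values. Every automorphism of P(7,1) permutes the quadrilaterals (7 ≠ 4,
-- so the prism is not a cube), hence belongs to D₇ × ℤ₂. D₇ acts on the quadrilaterals and
-- fixes the sign of the u-cycle; exchanging the cycles multiplies that sign by the product
-- of all quadrilaterals. Among the 18 bracelets of length 7, each of the 9 even ones
-- thus gives two orbits and each of the 9 odd ones a single orbit: 2·9 + 9 = 27.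

open import Defs
open import Algebra.Bundles using (CommutativeRing)
open import Data.Bool using (Bool; true; false; _xor_; _∧_; _∨_; not)
open import Data.Bool.Properties using (xor-∧-commutativeRing; xor-identityʳ; xor-comm; xor-same; ∨-identityʳ; ⇔→≡)
  renaming (_≟_ to _≟ᵇ_)
open import Data.Bool.Solver using (module xor-∧-Solver)
open import Data.Empty using (⊥; ⊥-elim)
open import Data.Fin using (Fin; zero; suc; toℕ; opposite; remQuot)
open import Data.Fin.Patterns
open import Data.Fin.Properties using () renaming (_≟_ to _≟ᶠ_; all? to ∀ᶠ?)
open import Data.List using (List; []; _∷_; _++_; map; allFin; cartesianProduct; cartesianProductWith)
open import Data.List.Membership.Propositional using (_∈_; lose)
open import Data.List.Membership.Propositional.Properties
  using (∈-allFin; ∈-map⁺; ∈-++⁺ˡ; ∈-++⁺ʳ; ∈-cartesianProduct⁺; ∈-cartesianProductWith⁺)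
open import Data.List.Relation.Unary.All as All using ()
open import Data.List.Relation.Unary.Any as Any using (here; there)
open import Data.Nat using (zero; suc)
open import Data.Nat.GeneralisedArithmetic using (fold)
open import Data.Product using (Σ; ∃; _×_; _,_; proj₁; proj₂; swap)
open import Data.Sum using (_⊎_; inj₁; inj₂)
open import Data.Vec using (Vec; []; _∷_; lookup; tabulate)
open import Data.Vec.Properties using (lookup∘tabulate)
open import Function using (_∘_)
open import Function.Bundles using (_⇔_; Inverse; Equivalence; mk⇔; mk↔ₛ′)
open import Relation.Binary using (DecidableEquality)
open import Relation.Binary.Construct.Closure.ReflexiveTransitive using (ε; _◅_; _◅◅_)
open import Relation.Binary.PropositionalEquality
open import Relation.Nullary using (¬_; Dec; yes; no; ¬?; _×-dec_; _⊎-dec_; _→-dec_)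
open import Relation.Nullary.Decidable using (⌊_⌋; map′; from-yes)
open import Relation.Unary using (Decidable)

open import Algebra.Properties.CommutativeMonoid.Sum
  (CommutativeRing.+-commutativeMonoid xor-∧-commutativeRing)
  using (sum; sum-cong-≗; ∑-distrib-+; sum-permute)
open xor-∧-Solver using (solve; con; _:+_; _:*_; _:=_)

-- Decidable quantification over finite types.

record Finite (A : Set) : Set where
  field
    elements : List A
    complete : ∀ x → x ∈ elements

open Finite

∀? : {A : Set} → Finite A → {P : A → Set} → Decidable P → Dec (∀ x → P x)
∀? fin P? = map′ (λ all x → All.lookup all (complete fin x))
                 (λ p → All.universal p (elements fin))
                 (All.all? P? (elements fin))

∃? : {A : Set} → Finite A → {P : A → Set} → Decidable P → Dec (∃ P)
∃? fin P? = map′ Any.satisfied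
                 (λ (x , p) → lose (complete fin x) p)
                 (Any.any? P? (elements fin))

bools : Finite Bool
bools .elements       = false ∷ true ∷ []
bools .complete false = here refl
bools .complete true  = there (here refl)

fins : ∀ {n} → Finite (Fin n)
fins .elements = allFin _
fins .complete = ∈-allFin

_⊗_ : {A B : Set} → Finite A → Finite B → Finite (A × B)
(a ⊗ b) .elements         = cartesianProduct (elements a) (elements b)
(a ⊗ b) .complete (x , y) = ∈-cartesianProduct⁺ (complete a x) (complete b y)

-- Functions `Fin n → A` that agree pointwise need not be propositionally equal, so searches over
-- them run through vectors.
vecs : {A : Set} → Finite A → ∀ n → Finite (Vec A n)
vecs a zero    .elements          = [] ∷ []
vecs a zero    .complete []       = here refl
vecs a (suc n) .elements          = cartesianProductWith _∷_ (elements a) (elements (vecs a n))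
vecs a (suc n) .complete (x ∷ xs) =
  ∈-cartesianProductWith⁺ _∷_ (complete a x) (complete (vecs a n) xs)

vertices : Finite Vertex
vertices .elements       = map u (allFin 7) ++ map v (allFin 7)
vertices .complete (u i) = ∈-++⁺ˡ (∈-map⁺ u (∈-allFin i))
vertices .complete (v i) = ∈-++⁺ʳ (map u (allFin 7)) (∈-map⁺ v (∈-allFin i))

_≟ⱽ_ : DecidableEquality Vertex
u i ≟ⱽ u j = map′ (cong u) (λ { refl → refl }) (i ≟ᶠ j)
v i ≟ⱽ v j = map′ (cong v) (λ { refl → refl }) (i ≟ᶠ j)
u _ ≟ⱽ v _ = no λ ()
v _ ≟ⱽ u _ = no λ ()

-- The 28 symmetries of the prism.

-- (k , r , s): rotation by k, preceded by a reflection if r, and exchanging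
-- the two 7-cycles if s.
Sym : Set
Sym = Fin 7 × Bool × Bool

syms : Finite Sym
syms = fins ⊗ (bools ⊗ bools)

rotate : Fin 7 → Fin 7 → Fin 7
rotate k i = fold i next (toℕ k)

-- The action on the quadrilaterals, the i-th of which lies between the columns i and next i.
face : Sym → Fin 7 → Fin 7
face (k , false , _) i = rotate k i
face (k , true  , _) i = rotate k (opposite i)

-- A reflection turns the quadrilateral i over, so that its left column i goes to the right one.
column : Sym → Fin 7 → Fin 7
column g@(_ , false , _) i = face g i
column g@(_ , true  , _) i = next (face g i)

onVertex : Sym → Vertex → Vertex
onVertex g@(_ , _ , false) (u i) = u (column g i)
onVertex g@(_ , _ , false) (v i) = v (column g i)
onVertex g@(_ , _ , true)  (u i) = v (column g i)
onVertex g@(_ , _ , true)  (v i) = u (column g i)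

onEdge : Sym → Edge → Edge
onEdge g@(_ , _ , false) (uu i) = uu (face g i)
onEdge g@(_ , _ , false) (vv i) = vv (face g i)
onEdge g@(_ , _ , true)  (uu i) = vv (face g i)
onEdge g@(_ , _ , true)  (vv i) = uu (face g i)
onEdge g                 (uv i) = uv (column g i)

exchanges : Sym → Bool
exchanges (_ , _ , s) = s

-- Invariants, their orbits and orbit representatives.

Inv : Set
Inv = (Fin 7 → Bool) × Bool

infix 4 _~[_]_ _~_

-- Here `x` holds the signs of the quadrilaterals and `p` that of the u-cycle. An exchange puts the
-- v-cycle in place of the u-cycle, and the sign of the v-cycle is `p xor sum x` by `sum-sq`.
_~[_]_ : Inv → Sym → Inv → Set
(x , p) ~[ g ] (y , q) =
  (q ≡ p xor (exchanges g ∧ sum x)) × (∀ i → y (face g i) ≡ x i)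

-- A record instead of a pair, so that `a` and `b` can be inferred from the type `a ~ b`.
record _~_ (a b : Inv) : Set where
  constructor _,_
  field
    by   : Sym
    acts : a ~[ by ] b

_~[_]?_ : ∀ a g b → Dec (a ~[ g ] b)
(x , p) ~[ g ]? (y , q) = (q ≟ᵇ _) ×-dec ∀ᶠ? (λ i → y (face g i) ≟ᵇ x i)

_~?_ : ∀ a b → Dec (a ~ b)
a ~? b = map′ (λ (g , e) → g , e) (λ (g , e) → g , e) (∃? syms λ g → a ~[ g ]? b)

-- Up to rotation and reflection there are one word of weight 0, three of weight 2, four of weight 4
-- and one of weight 6.
evenBracelet : Vec (Vec Bool 7) 9
evenBracelet =
  (o ∷ o ∷ o ∷ o ∷ o ∷ o ∷ o ∷ []) ∷
  (o ∷ o ∷ o ∷ o ∷ o ∷ l ∷ l ∷ []) ∷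
  (o ∷ o ∷ o ∷ o ∷ l ∷ o ∷ l ∷ []) ∷
  (o ∷ o ∷ o ∷ l ∷ o ∷ o ∷ l ∷ []) ∷
  (o ∷ o ∷ o ∷ l ∷ l ∷ l ∷ l ∷ []) ∷
  (o ∷ o ∷ l ∷ o ∷ l ∷ l ∷ l ∷ []) ∷
  (o ∷ o ∷ l ∷ l ∷ o ∷ l ∷ l ∷ []) ∷
  (o ∷ l ∷ o ∷ l ∷ o ∷ l ∷ l ∷ []) ∷
  (o ∷ l ∷ l ∷ l ∷ l ∷ l ∷ l ∷ []) ∷ []
  where
  o = false
  l = true

-- Complementing a vector of odd length exchanges even and odd weight. On odd weight
-- the exchange of the 7-cycles flips the second component, so that a single orbit lies above each bracelet.
rep : Fin 27 → Inv
rep k with remQuot {9} 3 k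
... | j , zero         = lookup (lookup evenBracelet j) , false
... | j , suc zero     = lookup (lookup evenBracelet j) , true
... | j , suc (suc _)  = not ∘ lookup (lookup evenBracelet j) , false

abstract
  -- Exhaustive: each of the 256 invariants is compared with the representatives under all
  -- symmetries.
  rep-complete : ∀ (x : Vec Bool 7) p → ∃ λ k → rep k ~ (lookup x , p)
  rep-complete = from-yes (∀? (vecs bools 7) λ x → ∀? bools λ p →
    ∃? fins λ k → rep k ~? (lookup x , p))

  rep-distinct : ∀ k l → rep k ~ rep l → k ≡ l
  rep-distinct = from-yes (∀? fins λ k → ∀? fins λ l → (rep k ~? rep l) →-dec (k ≟ᶠ l))

-- Group laws of the symmetries; `~` is symmetric and transitive.

prev : Fin 7 → Fin 7
prev i = fold i next 6

abstract
  -- Inverses and composites are found by search among the symmetries, which avoids formulas for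
  -- rotations combined with reflections.
  face-inverse : ∀ g → ∃ λ h → exchanges h ≡ exchanges g ×
    (∀ i → face h (face g i) ≡ i) × (∀ i → face g (face h i) ≡ i)
  face-inverse = from-yes (∀? syms λ g → ∃? syms λ h → (exchanges h ≟ᵇ exchanges g) ×-dec
    ∀ᶠ? (λ i → face h (face g i) ≟ᶠ i) ×-dec ∀ᶠ? (λ i → face g (face h i) ≟ᶠ i))

  face-compose : ∀ g h → ∃ λ m → exchanges m ≡ exchanges g xor exchanges h ×
    (∀ i → face m i ≡ face h (face g i))
  face-compose = from-yes (∀? syms λ g → ∀? syms λ h → ∃? syms λ m →
    (exchanges m ≟ᵇ exchanges g xor exchanges h) ×-dec
    ∀ᶠ? (λ i → face m i ≟ᶠ face h (face g i)))

  onVertex-inverse : ∀ g → ∃ λ h →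
    (∀ x → onVertex h (onVertex g x) ≡ x) × (∀ x → onVertex g (onVertex h x) ≡ x)
  onVertex-inverse = from-yes (∀? syms λ g → ∃? syms λ h →
    ∀? vertices (λ x → onVertex h (onVertex g x) ≟ⱽ x) ×-dec
    ∀? vertices (λ x → onVertex g (onVertex h x) ≟ⱽ x))

  -- The two columns bounding a quadrilateral go to those bounding its image, in the same order for
  -- a rotation and in the opposite order for a reflection.
  next-column : ∀ g i →
    (column g i ≡ face g i × column g (next i) ≡ next (face g i)) ⊎
    (column g i ≡ next (face g i) × column g (next i) ≡ face g i)
  next-column = from-yes (∀? syms λ g → ∀ᶠ? λ i →
    ((column g i ≟ᶠ face g i) ×-dec (column g (next i) ≟ᶠ next (face g i))) ⊎-dec
    ((column g i ≟ᶠ next (face g i)) ×-dec (column g (next i) ≟ᶠ face g i)))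

  next-next : ∀ i → ¬ (next (next i) ≡ i)
  next-next = from-yes (∀ᶠ? λ i → ¬? (next (next i) ≟ᶠ i))

  prev-next : ∀ i → prev (next i) ≡ i
  prev-next = from-yes (∀ᶠ? λ i → prev (next i) ≟ᶠ i)

  next-prev : ∀ i → next (prev i) ≡ i
  next-prev = from-yes (∀ᶠ? λ i → next (prev i) ≟ᶠ i)

sum-face : ∀ g x → sum (x ∘ face g) ≡ sum x
sum-face g x with face-inverse g
... | h , _ , hg , gh = sym (sum-permute x (mk↔ₛ′ (face g) (face h) gh hg))

sum-invariant : ∀ g x y → (∀ i → y (face g i) ≡ x i) → sum x ≡ sum y
sum-invariant g x y e = trans (sum-cong-≗ (sym ∘ e)) (sum-face g y)

xor-cancelʳ : ∀ a b → (a xor b) xor b ≡ a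
xor-cancelʳ = solve 2 (λ a b → (a :+ b) :+ b := a) refl

xor-cancelˡ : ∀ a b → a xor (a xor b) ≡ b
xor-cancelˡ = solve 2 (λ a b → a :+ (a :+ b) := b) refl

-- Both sides have the same parity `sum`, so the inverse symmetry repeats the same flip and cancels
-- it.
~-sym : ∀ {a b} → a ~ b → b ~ a
~-sym {x , p} {y , q} (g , pq , e) =
  let h , hs , _ , gh = face-inverse g in
  h ,
  (begin
    p                                                          ≡⟨ xor-cancelʳ p (exchanges g ∧ sum x) ⟨
    (p xor (exchanges g ∧ sum x)) xor (exchanges g ∧ sum x)    ≡⟨ cong₂ _xor_ pq (cong₂ _∧_ hs (sym (sum-invariant g x y e))) ⟨
    q xor (exchanges h ∧ sum y)                                ∎) ,
  λ i → trans (sym (e (face h i))) (cong y (gh i))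
  where open ≡-Reasoning

-- Since the parity is constant along an orbit, successive flips add up to the flip of the
-- composite.
~-trans : ∀ {a b c} → a ~ b → b ~ c → a ~ c
~-trans {x , p} {y , q} {z , r} (g , pq , e) (h , qr , f) =
  let m , ms , mf = face-compose g h in
  m ,
  (begin
    r                                                          ≡⟨ qr ⟩
    q xor (exchanges h ∧ sum y)                                ≡⟨ cong₂ _xor_ pq (cong (exchanges h ∧_) (sym (sum-invariant g x y e))) ⟩
    (p xor (exchanges g ∧ sum x)) xor (exchanges h ∧ sum x)    ≡⟨ combine-flips p (exchanges g) (exchanges h) (sum x) ⟩
    p xor ((exchanges g xor exchanges h) ∧ sum x)              ≡⟨ cong (λ s → p xor (s ∧ sum x)) ms ⟨
    p xor (exchanges m ∧ sum x)                                ∎) ,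
  λ i → trans (cong z (mf i)) (trans (f (face g i)) (e i))
  where
  open ≡-Reasoning
  combine-flips : ∀ p a b s → (p xor (a ∧ s)) xor (b ∧ s) ≡ p xor ((a xor b) ∧ s)
  combine-flips = solve 4 (λ p a b s → (p :+ a :* s) :+ b :* s := p :+ (a :+ b) :* s) refl

-- Edges under the symmetries, and the automorphisms these induce.

Joins-sym : ∀ {e x y} → Joins e x y → Joins e y x
Joins-sym (inj₁ p) = inj₂ p
Joins-sym (inj₂ p) = inj₁ p

ends-injective : ∀ e e′ → ends e ≡ ends e′ → e ≡ e′
ends-injective (uu _) (uu _) refl = refl
ends-injective (vv _) (vv _) refl = refl
ends-injective (uv _) (uv _) refl = refl

index : Vertex → Fin 7
index (u i) = i
index (v i) = i

no-2-cycle : ∀ {i j} → i ≡ next j → next i ≡ j → ⊥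
no-2-cycle {j = j} refl = next-next j

-- The hypothesis is contradictory: reversed cycle edges would give a cycle of length 2, and every
-- rung runs from `u` to `v`.
ends-swap : ∀ e e′ → ends e ≡ swap (ends e′) → e ≡ e′
ends-swap (uu _) (uu _) p = ⊥-elim (no-2-cycle (cong (index ∘ proj₁) p) (cong (index ∘ proj₂) p))
ends-swap (vv _) (vv _) p = ⊥-elim (no-2-cycle (cong (index ∘ proj₁) p) (cong (index ∘ proj₂) p))
ends-swap (uu _) (uv _) ()
ends-swap (vv _) (uv _) ()
ends-swap (uv _) (uv _) ()

Joins-unique : ∀ {e e′ x y} → Joins e x y → Joins e′ x y → e ≡ e′
Joins-unique {e} {e′} (inj₁ p) (inj₁ q) = ends-injective e e′ (trans p (sym q))
Joins-unique {e} {e′} (inj₂ p) (inj₂ q) = ends-injective e e′ (trans p (sym q))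
Joins-unique {e} {e′} (inj₁ p) (inj₂ q) = ends-swap e e′ (trans p (cong swap (sym q)))
Joins-unique {e} {e′} (inj₂ p) (inj₁ q) = ends-swap e e′ (trans p (cong swap (sym q)))

onEdge-ends : ∀ g e → Joins (onEdge g e) (onVertex g (proj₁ (ends e))) (onVertex g (proj₂ (ends e)))
onEdge-ends g@(_ , _ , false) (uu i) with next-column g i
... | inj₁ (a , b) = inj₁ (cong₂ (λ i j → u i , u j) (sym a) (sym b))
... | inj₂ (a , b) = inj₂ (cong₂ (λ i j → u i , u j) (sym b) (sym a))
onEdge-ends g@(_ , _ , false) (vv i) with next-column g i
... | inj₁ (a , b) = inj₁ (cong₂ (λ i j → v i , v j) (sym a) (sym b))
... | inj₂ (a , b) = inj₂ (cong₂ (λ i j → v i , v j) (sym b) (sym a))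
onEdge-ends g@(_ , _ , true) (uu i) with next-column g i
... | inj₁ (a , b) = inj₁ (cong₂ (λ i j → v i , v j) (sym a) (sym b))
... | inj₂ (a , b) = inj₂ (cong₂ (λ i j → v i , v j) (sym b) (sym a))
onEdge-ends g@(_ , _ , true) (vv i) with next-column g i
... | inj₁ (a , b) = inj₁ (cong₂ (λ i j → u i , u j) (sym a) (sym b))
... | inj₂ (a , b) = inj₂ (cong₂ (λ i j → u i , u j) (sym b) (sym a))
onEdge-ends (_ , _ , false) (uv i) = inj₁ refl
onEdge-ends (_ , _ , true)  (uv i) = inj₂ refl

onEdge-Joins : ∀ g {e x y} → Joins e x y → Joins (onEdge g e) (onVertex g x) (onVertex g y)
onEdge-Joins g {e} (inj₁ refl) = onEdge-ends g e
onEdge-Joins g {e} (inj₂ refl) = Joins-sym {onEdge g e} (onEdge-ends g e)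

-- The graph is simple, so an edge is determined by its ends and the inverse on vertices carries
-- over.
onEdge-inverse : ∀ g h → (∀ x → onVertex h (onVertex g x) ≡ x) → ∀ e → onEdge h (onEdge g e) ≡ e
onEdge-inverse g h hg e = Joins-unique
  (subst₂ (Joins _) (hg _) (hg _) (onEdge-Joins h {onEdge g e} (onEdge-ends g e))) (inj₁ refl)

automorphism : Sym → Automorphism
automorphism g with onVertex-inverse g
... | h , hg , gh = record
  { perm     = mk↔ₛ′ (onVertex g) (onVertex h) gh hg
  ; preserve = λ x y → mk⇔
      (λ (e , j) → onEdge g e , onEdge-Joins g {e} j)
      (λ (e , j) → onEdge h e , subst₂ (Joins _) (hg x) (hg y) (onEdge-Joins h {e} j))
  }

to : Automorphism → Vertex → Vertex
to ψ = Inverse.to (Automorphism.perm ψ)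

to-automorphism : ∀ g x → to (automorphism g) x ≡ onVertex g x
to-automorphism g x with onVertex-inverse g
... | _ = refl

-- Every automorphism is one of the 28 symmetries.

neighbours : Vertex → List Vertex
neighbours (u i) = u (next i) ∷ u (prev i) ∷ v i ∷ []
neighbours (v i) = v (next i) ∷ v (prev i) ∷ u i ∷ []

Adj⇒∈ : ∀ {x y} → Adj x y → y ∈ neighbours x
Adj⇒∈ (uu _ , inj₁ refl) = here refl
Adj⇒∈ (uu i , inj₂ refl) = there (here (cong u (sym (prev-next i))))
Adj⇒∈ (vv _ , inj₁ refl) = here refl
Adj⇒∈ (vv i , inj₂ refl) = there (here (cong v (sym (prev-next i))))
Adj⇒∈ (uv _ , inj₁ refl) = there (there (here refl))
Adj⇒∈ (uv _ , inj₂ refl) = there (there (here refl))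

_∈?_ : ∀ x (xs : List Vertex) → Dec (x ∈ xs)
x ∈? xs = Any.any? (x ≟ⱽ_) xs

∀∈? : ∀ (xs : List Vertex) {P : Vertex → Set} → Decidable P → Dec (∀ x → x ∈ xs → P x)
∀∈? xs P? = map′ (λ all x → All.lookup all) (λ p → All.tabulate (λ {x} → p x)) (All.all? P? xs)

_≢?_ : ∀ (x y : Vertex) → Dec (x ≢ y)
x ≢? y = ¬? (x ≟ⱽ y)

abstract
  -- An edge bd shared by the two quadrilaterals abdc and bdfe is a rung (this fails in the cube).
  ladder : ∀ a b → b ∈ neighbours a → ∀ c → c ∈ neighbours a → b ≢ c →
    ∀ d → d ∈ neighbours b → d ∈ neighbours c → d ≢ a →
    ∀ e → e ∈ neighbours b → e ≢ a → e ≢ d →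
    ∀ f → f ∈ neighbours d → f ∈ neighbours e → f ≢ b → f ≢ c →
    ∃ λ g → (a ≡ onVertex g (u zero) × c ≡ onVertex g (v zero)) ×
            (b ≡ onVertex g (u (suc zero)) × d ≡ onVertex g (v (suc zero)))
  ladder = from-yes (∀? vertices λ a →
    ∀∈? (neighbours a) λ b → ∀∈? (neighbours a) λ c → (b ≢? c) →-dec
    ∀∈? (neighbours b) λ d → (d ∈? neighbours c) →-dec ((d ≢? a) →-dec
    ∀∈? (neighbours b) λ e → (e ≢? a) →-dec ((e ≢? d) →-dec
    ∀∈? (neighbours d) λ f → (f ∈? neighbours e) →-dec ((f ≢? b) →-dec ((f ≢? c) →-dec
    ∃? syms λ g →
      ((a ≟ⱽ onVertex g (u zero)) ×-dec (c ≟ⱽ onVertex g (v zero))) ×-dec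
      ((b ≟ⱽ onVertex g (u (suc zero))) ×-dec (d ≟ⱽ onVertex g (v (suc zero)))))))))

  -- The graph is cubic: once the previous cycle vertex and the rung partner are excluded, one
  -- neighbour remains.
  extend-u : ∀ g i x → x ∈ neighbours (onVertex g (u (next i))) →
    x ≢ onVertex g (u i) → x ≢ onVertex g (v (next i)) → x ≡ onVertex g (u (next (next i)))
  extend-u = from-yes (∀? syms λ g → ∀ᶠ? λ i →
    ∀∈? (neighbours (onVertex g (u (next i)))) λ x →
    (x ≢? onVertex g (u i)) →-dec ((x ≢? onVertex g (v (next i))) →-dec
    (x ≟ⱽ onVertex g (u (next (next i))))))

  extend-v : ∀ g i x → x ∈ neighbours (onVertex g (v (next i))) →
    x ≢ onVertex g (v i) → x ≢ onVertex g (u (next i)) → x ≡ onVertex g (v (next (next i)))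
  extend-v = from-yes (∀? syms λ g → ∀ᶠ? λ i →
    ∀∈? (neighbours (onVertex g (v (next i)))) λ x →
    (x ≢? onVertex g (v i)) →-dec ((x ≢? onVertex g (u (next i))) →-dec
    (x ≟ⱽ onVertex g (v (next (next i))))))

module _ (f : Vertex → Vertex) (f-injective : ∀ {x y} → f x ≡ f y → x ≡ y)
         (f-adj : ∀ {x y} → Adj x y → Adj (f x) (f y)) where

  f-near : ∀ {x y} → Adj x y → f y ∈ neighbours (f x)
  f-near a = Adj⇒∈ (f-adj a)

  Agree : Sym → Fin 7 → Set
  Agree g i = (f (u i) ≡ onVertex g (u i)) × (f (v i) ≡ onVertex g (v i))

  -- Injectivity keeps the image of the next cycle vertex away from the two neighbours already
  -- taken, so `extend-u` and `extend-v` determine it.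
  agree-next : ∀ g i → Agree g i → Agree g (next i) → Agree g (next (next i))
  agree-next g i (p , q) (p′ , q′) =
    extend-u g i _ (subst (λ y → _ ∈ neighbours y) p′ (f-near (uu (next i) , inj₁ refl)))
      (λ r → next-next i (cong index (f-injective (trans r (sym p)))))
      (λ r → u≢v (f-injective (trans r (sym q′)))) ,
    extend-v g i _ (subst (λ y → _ ∈ neighbours y) q′ (f-near (vv (next i) , inj₁ refl)))
      (λ r → next-next i (cong index (f-injective (trans r (sym q)))))
      (λ r → u≢v (f-injective (trans p′ (sym r))))
    where
    u≢v : ∀ {i j} → u i ≢ v j
    u≢v ()

  -- The images of u₀, u₁, v₀, v₁, u₂, v₂ serve as a, b, c, d, e, f in `ladder`: the first two
  -- quadrilaterals share the rung u₁v₁.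
  agree-first : ∃ λ g → Agree g zero × Agree g (suc zero)
  agree-first = ladder
    _ _ (f-near (uu zero , inj₁ refl)) _ (f-near (uv zero , inj₁ refl)) (distinct λ ())
    _ (f-near (uv one , inj₁ refl)) (f-near (vv zero , inj₁ refl)) (distinct λ ())
    _ (f-near (uu one , inj₁ refl)) (distinct λ ()) (distinct λ ())
    _ (f-near (vv one , inj₁ refl)) (f-near (uv (next one) , inj₁ refl)) (distinct λ ()) (distinct λ ())
    where
    one : Fin 7
    one = suc zero
    distinct : ∀ {x y} → x ≢ y → f x ≢ f y
    distinct x≢y = x≢y ∘ f-injective

  agree-everywhere : ∃ λ g → ∀ x → f x ≡ onVertex g x
  agree-everywhere with agree-first
  ... | g , a₀ , a₁ = g , λ { (u i) → proj₁ (agree i) ; (v i) → proj₂ (agree i) }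
    where
    a₂ = agree-next g _ a₀ a₁
    a₃ = agree-next g _ a₁ a₂
    a₄ = agree-next g _ a₂ a₃
    a₅ = agree-next g _ a₃ a₄
    a₆ = agree-next g _ a₄ a₅
    agree : ∀ i → Agree g i
    agree 0F = a₀
    agree 1F = a₁
    agree 2F = a₂
    agree 3F = a₃
    agree 4F = a₄
    agree 5F = a₅
    agree 6F = a₆

automorphisms : ∀ ψ → ∃ λ g → ∀ x → to ψ x ≡ onVertex g x
automorphisms ψ = agree-everywhere (to ψ)
  (λ {x} {y} p → trans (sym (strictlyInverseʳ x)) (trans (cong from p) (strictlyInverseʳ y)))
  (λ {x} {y} → Equivalence.to (preserve x y))
  where
  open Automorphism ψ
  open Inverse perm using (from; strictlyInverseʳ)

-- The switching invariant.

sq : Signature → Fin 7 → Bool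
sq σ i = σ (uu i) xor (σ (vv i) xor (σ (uv i) xor σ (uv (next i))))

inv : Signature → Inv
inv σ = sq σ , sum (σ ∘ uu)

sum-next : ∀ x → sum (x ∘ next) ≡ sum x
sum-next x = sym (sum-permute x (mk↔ₛ′ next prev next-prev prev-next))

-- Each rung lies in two quadrilaterals, so the rungs cancel in the total.
sum-sq : ∀ σ → sum (sq σ) ≡ sum (σ ∘ uu) xor sum (σ ∘ vv)
sum-sq σ = begin
  sum (sq σ)
    ≡⟨ ∑-distrib-+ (σ ∘ uu) (λ i → σ (vv i) xor (σ (uv i) xor σ (uv (next i)))) ⟩
  U xor sum (λ i → σ (vv i) xor (σ (uv i) xor σ (uv (next i))))
    ≡⟨ cong (U xor_) (∑-distrib-+ (σ ∘ vv) (λ i → σ (uv i) xor σ (uv (next i)))) ⟩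
  U xor (V xor sum (λ i → σ (uv i) xor σ (uv (next i))))
    ≡⟨ cong (λ r → U xor (V xor r)) (∑-distrib-+ (σ ∘ uv) (σ ∘ uv ∘ next)) ⟩
  U xor (V xor (R xor sum (σ ∘ uv ∘ next)))
    ≡⟨ cong (λ r → U xor (V xor (R xor r))) (sum-next (σ ∘ uv)) ⟩
  U xor (V xor (R xor R))
    ≡⟨ solve 3 (λ U V R → U :+ (V :+ (R :+ R)) := U :+ V) refl U V R ⟩
  U xor V ∎
  where
  open ≡-Reasoning
  U V R : Bool
  U = sum (σ ∘ uu)
  V = sum (σ ∘ vv)
  R = sum (σ ∘ uv)

atZero : ∀ {n} → Bool → Fin n → Bool
atZero p zero    = p
atZero p (suc _) = false

-- No rung is negative, and among the edges uu i at most uu zero is.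
realize : Inv → Signature
realize (_ , p) (uu i) = atZero p i
realize (x , p) (vv i) = atZero p i xor x i
realize _       (uv _) = false

infix 4 _≈_

_≈_ : Inv → Inv → Set
(x , p) ≈ (y , q) = (∀ i → x i ≡ y i) × p ≡ q

inv-realize : ∀ a → inv (realize a) ≈ a
inv-realize (x , p) =
  (λ i → solve 2 (λ a b → a :+ ((a :+ b) :+ con false) := b) refl (atZero p i) (x i)) ,
  xor-identityʳ p

_⊕_ : Signature → Signature → Signature
(σ ⊕ τ) e = σ e xor τ e

-- Linearity over the two-element field: a resigning adds `incident w`, so its effect on `sq` is
-- that of a vertex star alone.
sq-⊕ : ∀ σ τ i → sq (σ ⊕ τ) i ≡ sq σ i xor sq τ i
sq-⊕ σ τ i = solve 8
  (λ a b c d a′ b′ c′ d′ → (a :+ a′) :+ ((b :+ b′) :+ ((c :+ c′) :+ (d :+ d′))) :=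
    (a :+ (b :+ (c :+ d))) :+ (a′ :+ (b′ :+ (c′ :+ d′)))) refl
  (σ (uu i)) (σ (vv i)) (σ (uv i)) (σ (uv (next i)))
  (τ (uu i)) (τ (vv i)) (τ (uv i)) (τ (uv (next i)))

abstract
  -- A vertex is incident with none or two of the edges of a cycle; the same reason gives
  -- `uu-incident`.
  sq-incident : ∀ w i → sq (incident w) i ≡ false
  sq-incident = from-yes (∀? vertices λ w → ∀ᶠ? λ i → sq (incident w) i ≟ᵇ false)

  uu-incident : ∀ w → sum (incident w ∘ uu) ≡ false
  uu-incident = from-yes (∀? vertices λ w → sum (incident w ∘ uu) ≟ᵇ false)

sq-cong : ∀ {σ τ} → (∀ e → σ e ≡ τ e) → ∀ i → sq σ i ≡ sq τ i
sq-cong e i = cong₂ _xor_ (e _) (cong₂ _xor_ (e _) (cong₂ _xor_ (e _) (e _)))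

inv-step : ∀ {σ τ} → ResignStep σ τ → inv τ ≈ inv σ
inv-step {σ} {τ} (w , e) =
  (λ i → begin
    sq τ i                           ≡⟨ sq-cong e i ⟩
    sq (σ ⊕ incident w) i            ≡⟨ sq-⊕ σ (incident w) i ⟩
    sq σ i xor sq (incident w) i     ≡⟨ cong (sq σ i xor_) (sq-incident w i) ⟩
    sq σ i xor false                 ≡⟨ xor-identityʳ _ ⟩
    sq σ i                           ∎) ,
  (begin
    sum (τ ∘ uu)                             ≡⟨ sum-cong-≗ (e ∘ uu) ⟩
    sum ((σ ⊕ incident w) ∘ uu)              ≡⟨ ∑-distrib-+ (σ ∘ uu) (incident w ∘ uu) ⟩
    sum (σ ∘ uu) xor sum (incident w ∘ uu)   ≡⟨ cong (sum (σ ∘ uu) xor_) (uu-incident w) ⟩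
    sum (σ ∘ uu) xor false                   ≡⟨ xor-identityʳ _ ⟩
    sum (σ ∘ uu)                             ∎)
  where open ≡-Reasoning

≈-trans : ∀ {a b c} → a ≈ b → b ≈ c → a ≈ c
≈-trans (e , p) (f , q) = (λ i → trans (e i) (f i)) , trans p q

inv-switch : ∀ {σ τ} → SwitchEq σ τ → inv τ ≈ inv σ
inv-switch ε        = (λ _ → refl) , refl
inv-switch {σ} {τ} (_◅_ {j = ρ} s ss) = ≈-trans {inv τ} {inv ρ} {inv σ} (inv-switch ss) (inv-step {σ} {ρ} s)

-- Equal invariants imply switching equivalence.

-- A chain of resignings ends in one particular function; resigning twice at
-- the same vertex replaces it by any pointwise equal one.
≗⇒SwitchEq : ∀ {σ τ} → (∀ e → τ e ≡ σ e) → SwitchEq σ τ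
≗⇒SwitchEq {σ} e = (u zero , λ _ → refl) ◅
  (u zero , λ x → trans (e x) (sym (xor-cancelʳ (σ x) (incident (u zero) x)))) ◅ ε

-- Resign at `w j` exactly when `f j` is true, one index at a time.
resignings : ∀ {n} (w : Fin n → Vertex) (f : Fin n → Bool) {σ τ} →
  (∀ e → τ e ≡ σ e xor sum (λ j → incident (w j) e ∧ f j)) → SwitchEq σ τ
resignings {zero}  w f {σ} h = ≗⇒SwitchEq (λ e → trans (h e) (xor-identityʳ (σ e)))
resignings {suc n} w f {σ} h with f zero
... | false = resignings (w ∘ suc) (f ∘ suc) λ e → trans (h e)
  (solve 3 (λ a b c → a :+ (b :* con false :+ c) := a :+ c) refl (σ e) (incident (w zero) e) _)
... | true  = (w zero , λ _ → refl) ◅ resignings (w ∘ suc) (f ∘ suc) λ e → trans (h e)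
  (solve 3 (λ a b c → a :+ (b :* con true :+ c) := (a :+ b) :+ c) refl (σ e) (incident (w zero) e) _)

prefix : ∀ {n} → (Fin n → Bool) → Fin n → Bool
prefix c zero    = false
prefix c (suc i) = c zero xor prefix (c ∘ suc) i

abstract
  -- Consecutive partial sums differ by one entry; at the last index, where `next` returns to zero,
  -- the vanishing total closes the cycle.
  prefix-next : ∀ (c : Vec Bool 7) → sum (lookup c) ≡ false →
    ∀ i → prefix (lookup c) i xor prefix (lookup c) (next i) ≡ lookup c i
  prefix-next = from-yes (∀? (vecs bools 7) λ c → (sum (lookup c) ≟ᵇ false) →-dec
    ∀ᶠ? λ i → prefix (lookup c) i xor prefix (lookup c) (next i) ≟ᵇ lookup c i)

potential : ∀ c → sum c ≡ false → ∃ λ f → ∀ i → f i xor f (next i) ≡ c i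
potential c c≡0 = prefix (lookup (tabulate c)) , λ i →
  trans (prefix-next (tabulate c) (trans (sum-cong-≗ (lookup∘tabulate c)) c≡0) i) (lookup∘tabulate c i)

sum-select : ∀ (f : Fin 7 → Bool) i → sum (λ j → ⌊ j ≟ᶠ i ⌋ ∧ f j) ≡ f i
sum-select f 0F = xor-identityʳ _
sum-select f 1F = xor-identityʳ _
sum-select f 2F = xor-identityʳ _
sum-select f 3F = xor-identityʳ _
sum-select f 4F = xor-identityʳ _
sum-select f 5F = xor-identityʳ _
sum-select f 6F = xor-identityʳ _

-- `∨` and `xor` differ only when both arguments are true, which `i ≢ k` excludes.
sum-select-∨ : ∀ (f : Fin 7 → Bool) i k → i ≢ k →
  sum (λ j → (⌊ j ≟ᶠ i ⌋ ∨ ⌊ j ≟ᶠ k ⌋) ∧ f j) ≡ f i xor f k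
sum-select-∨ f i k i≢k = begin
  sum (λ j → (⌊ j ≟ᶠ i ⌋ ∨ ⌊ j ≟ᶠ k ⌋) ∧ f j)                      ≡⟨ sum-cong-≗ split ⟩
  sum (λ j → (⌊ j ≟ᶠ i ⌋ ∧ f j) xor (⌊ j ≟ᶠ k ⌋ ∧ f j))            ≡⟨ ∑-distrib-+ (λ j → ⌊ j ≟ᶠ i ⌋ ∧ f j) (λ j → ⌊ j ≟ᶠ k ⌋ ∧ f j) ⟩
  sum (λ j → ⌊ j ≟ᶠ i ⌋ ∧ f j) xor sum (λ j → ⌊ j ≟ᶠ k ⌋ ∧ f j)    ≡⟨ cong₂ _xor_ (sum-select f i) (sum-select f k) ⟩
  f i xor f k                                                      ∎
  where
  open ≡-Reasoning
  split : ∀ j → (⌊ j ≟ᶠ i ⌋ ∨ ⌊ j ≟ᶠ k ⌋) ∧ f j ≡ (⌊ j ≟ᶠ i ⌋ ∧ f j) xor (⌊ j ≟ᶠ k ⌋ ∧ f j)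
  split j with j ≟ᶠ i | j ≟ᶠ k
  ... | yes refl | yes refl = ⊥-elim (i≢k refl)
  ... | yes _    | no _     = sym (xor-identityʳ _)
  ... | no _     | _        = refl

-- Extended along the rungs, a is a potential for σ ⊕ τ on the whole graph,
-- because σ and τ agree on the quadrilaterals; resign wherever it is true.
potential⇒SwitchEq : ∀ σ τ → (∀ i → sq σ i ≡ sq τ i) → (a : Fin 7 → Bool) →
  (∀ i → a i xor a (next i) ≡ (σ ⊕ τ) (uu i)) → SwitchEq σ τ
potential⇒SwitchEq σ τ sq≡ a a-next =
  resignings u a {σ} {ρ} (λ _ → refl) ◅◅ resignings v b {ρ} {τ} τ≡
  where
  open ≡-Reasoning
  b : Fin 7 → Bool
  -- This value makes the resignings at both ends of rung i change its sign by exactly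
  -- `(σ ⊕ τ) (uv i)`.
  b i = a i xor (σ ⊕ τ) (uv i)
  ρ : Signature
  ρ e = σ e xor sum (λ j → incident (u j) e ∧ a j)
  i≢next : ∀ i → i ≢ next i
  i≢next i i≡ = next-next i (trans (cong next (sym i≡)) (sym i≡))
  τ≡ : ∀ e → τ e ≡ ρ e xor sum (λ j → incident (v j) e ∧ b j)
  τ≡ (uu i) = sym (begin
    (σ (uu i) xor sum (λ j → incident (u j) (uu i) ∧ a j)) xor false
      ≡⟨ xor-identityʳ (ρ (uu i)) ⟩
    σ (uu i) xor sum (λ j → incident (u j) (uu i) ∧ a j)
      ≡⟨ cong (σ (uu i) xor_) (trans (sum-select-∨ a i (next i) (i≢next i)) (a-next i)) ⟩
    σ (uu i) xor (σ (uu i) xor τ (uu i))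
      ≡⟨ xor-cancelˡ (σ (uu i)) (τ (uu i)) ⟩
    τ (uu i) ∎)
  τ≡ (vv i) = sym (begin
    (σ (vv i) xor false) xor sum (λ j → incident (v j) (vv i) ∧ b j)
      ≡⟨ cong ((σ (vv i) xor false) xor_) (sum-select-∨ b i (next i) (i≢next i)) ⟩
    (σ (vv i) xor false) xor (b i xor b (next i))
      ≡⟨ solve 7 (λ s a a′ c d c′ d′ → (s :+ con false) :+ ((a :+ (c :+ d)) :+ (a′ :+ (c′ :+ d′))) :=
           s :+ ((a :+ a′) :+ ((c :+ c′) :+ (d :+ d′)))) refl
           (σ (vv i)) (a i) (a (next i)) (σ (uv i)) (τ (uv i)) (σ (uv (next i))) (τ (uv (next i))) ⟩
    σ (vv i) xor ((a i xor a (next i)) xor ((σ (uv i) xor σ (uv (next i))) xor (τ (uv i) xor τ (uv (next i)))))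
      ≡⟨ cong (λ r → σ (vv i) xor (r xor ((σ (uv i) xor σ (uv (next i))) xor (τ (uv i) xor τ (uv (next i)))))) (a-next i) ⟩
    σ (vv i) xor ((σ (uu i) xor τ (uu i)) xor ((σ (uv i) xor σ (uv (next i))) xor (τ (uv i) xor τ (uv (next i)))))
      -- Adding `τ (vv i)` twice completes the terms to both quadrilateral signs, which then cancel.
      ≡⟨ solve 6 (λ A B C A′ B′ C′ → B :+ ((A :+ A′) :+ (C :+ C′)) :=
           (A :+ (B :+ C)) :+ ((A′ :+ (B′ :+ C′)) :+ B′)) refl
           (σ (uu i)) (σ (vv i)) (σ (uv i) xor σ (uv (next i)))
           (τ (uu i)) (τ (vv i)) (τ (uv i) xor τ (uv (next i))) ⟩
    sq σ i xor (sq τ i xor τ (vv i))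
      ≡⟨ cong (_xor (sq τ i xor τ (vv i))) (sq≡ i) ⟩
    sq τ i xor (sq τ i xor τ (vv i))
      ≡⟨ xor-cancelˡ (sq τ i) (τ (vv i)) ⟩
    τ (vv i) ∎)
  τ≡ (uv i) = sym (begin
    ρ (uv i) xor sum (λ j → incident (v j) (uv i) ∧ b j)
      ≡⟨ cong₂ (λ x y → (σ (uv i) xor x) xor y)
           (trans (sum-cong-≗ (λ j → cong (_∧ a j) (∨-identityʳ ⌊ j ≟ᶠ i ⌋))) (sum-select a i)) (sum-select b i) ⟩
    (σ (uv i) xor a i) xor (a i xor (σ (uv i) xor τ (uv i)))
      ≡⟨ solve 3 (λ s a t → (s :+ a) :+ (a :+ (s :+ t)) := t) refl (σ (uv i)) (a i) (τ (uv i)) ⟩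
    τ (uv i) ∎)

-- Equal signs of the u-cycle mean that `σ ⊕ τ` sums to zero around it, which is the condition for a
-- potential.
≈⇒SwitchEq : ∀ σ τ → inv σ ≈ inv τ → SwitchEq σ τ
≈⇒SwitchEq σ τ (sq≡ , p≡) =
  let a , a-next = potential ((σ ⊕ τ) ∘ uu) (begin
        sum ((σ ⊕ τ) ∘ uu)                ≡⟨ ∑-distrib-+ (σ ∘ uu) (τ ∘ uu) ⟩
        sum (σ ∘ uu) xor sum (τ ∘ uu)     ≡⟨ cong (_xor sum (τ ∘ uu)) p≡ ⟩
        sum (τ ∘ uu) xor sum (τ ∘ uu)     ≡⟨ xor-same (sum (τ ∘ uu)) ⟩
        false                             ∎)
  in potential⇒SwitchEq σ τ sq≡ a a-next
  where open ≡-Reasoning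

-- Invariants under automorphisms.

~-respʳ : ∀ a b c → a ~ b → b ≈ c → a ~ c
~-respʳ _ _ _ (g , p , e) (f , q) = g , trans (sym q) p , λ i → trans (sym (f _)) (e i)

~[]-functional : ∀ g a b c → a ~[ g ] b → a ~[ g ] c → b ≈ c
~[]-functional g (x , _) (y , _) (z , _) (p , e) (q , f) =
  let h , _ , _ , gh = face-inverse g in
  (λ i → subst (λ j → y j ≡ z j) (gh i) (trans (e (face h i)) (sym (f (face h i))))) ,
  trans p (sym q)

rung-onEdge : ∀ g i → onEdge g (uv i) ≡ uv (column g i)
rung-onEdge (_ , _ , false) i = refl
rung-onEdge (_ , _ , true)  i = refl

-- The boundary of quadrilateral i goes to that of its image; a reflection swaps its rungs and an
-- exchange its cycle edges, neither of which affects the product.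
sq-onEdge : ∀ g τ i → sq (τ ∘ onEdge g) i ≡ sq τ (face g i)
sq-onEdge g τ i = trans (cong (λ r → τ (onEdge g (uu i)) xor (τ (onEdge g (vv i)) xor r)) rungs) (cycles g)
  where
  rungs : τ (onEdge g (uv i)) xor τ (onEdge g (uv (next i))) ≡ τ (uv (face g i)) xor τ (uv (next (face g i)))
  rungs rewrite rung-onEdge g i | rung-onEdge g (next i) with next-column g i
  ... | inj₁ (p , q) = cong₂ (λ a b → τ (uv a) xor τ (uv b)) p q
  ... | inj₂ (p , q) = trans (cong₂ (λ a b → τ (uv a) xor τ (uv b)) p q) (xor-comm (τ (uv (next (face g i)))) _)
  cycles : ∀ g {r} → τ (onEdge g (uu i)) xor (τ (onEdge g (vv i)) xor r) ≡
    τ (uu (face g i)) xor (τ (vv (face g i)) xor r)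
  cycles (_ , _ , false) = refl
  cycles g@(_ , _ , true) {r} =
    solve 3 (λ a b r → b :+ (a :+ r) := a :+ (b :+ r)) refl (τ (uu (face g i))) (τ (vv (face g i))) r

-- After an exchange, `sum (τ ∘ uu)` is the v-cycle sign of the pulled back signature, which
-- `sum-sq` expresses through the u-cycle and the quadrilaterals.
uu-onEdge : ∀ g τ → sum (τ ∘ uu) ≡
  sum (τ ∘ onEdge g ∘ uu) xor (exchanges g ∧ sum (sq (τ ∘ onEdge g)))
uu-onEdge g@(_ , _ , false) τ = sym (trans (xor-identityʳ _) (sum-face g (τ ∘ uu)))
uu-onEdge g@(_ , _ , true)  τ = sym (begin
  U xor sum (sq (τ ∘ onEdge g))    ≡⟨ cong (U xor_) (sum-sq (τ ∘ onEdge g)) ⟩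
  U xor (U xor V)                  ≡⟨ xor-cancelˡ U V ⟩
  V                                ≡⟨ sum-face g (τ ∘ uu) ⟩
  sum (τ ∘ uu)                     ∎)
  where
  open ≡-Reasoning
  U V : Bool
  U = sum (τ ∘ onEdge g ∘ uu)
  V = sum (τ ∘ onEdge g ∘ vv)

inv-onEdge : ∀ g τ → inv (τ ∘ onEdge g) ~[ g ] inv τ
inv-onEdge g τ = uu-onEdge g τ , λ i → sym (sq-onEdge g τ i)

inv-cong : ∀ {σ τ} → (∀ e → σ e ≡ τ e) → inv σ ≈ inv τ
inv-cong e = sq-cong e , sum-cong-≗ (e ∘ uu)

onEdge-preimage : ∀ g → ∃ λ (h : Edge → Edge) →
  (∀ e → h (onEdge g e) ≡ e) × (∀ e → onEdge g (h e) ≡ e)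
onEdge-preimage g =
  let h , hg , gh = onVertex-inverse g in
  onEdge h , onEdge-inverse g h hg , onEdge-inverse h g gh

module _ (g : Sym) (ψ : Automorphism) (ψ≡g : ∀ x → to ψ x ≡ onVertex g x) where

  Joins-to : ∀ {e′} e → Joins e′ (to ψ (proj₁ (ends e))) (to ψ (proj₂ (ends e))) → e′ ≡ onEdge g e
  Joins-to e j = Joins-unique (subst₂ (Joins _) (ψ≡g _) (ψ≡g _) j) (onEdge-ends g e)

  onEdge-Joins-to : ∀ e → Joins (onEdge g e) (to ψ (proj₁ (ends e))) (to ψ (proj₂ (ends e)))
  onEdge-Joins-to e = subst₂ (Joins _) (sym (ψ≡g _)) (sym (ψ≡g _)) (onEdge-ends g e)

  image⇒pullback : ∀ {σ τ : Signature} → (∀ e → (τ e ≡ true) ⇔ InImage ψ σ e) → ∀ e → τ (onEdge g e) ≡ σ e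
  image⇒pullback {σ} {τ} image e = ⇔→≡ (mk⇔ back forth)
    where
    back : τ (onEdge g e) ≡ true → σ e ≡ true
    back t with Equivalence.to (image (onEdge g e)) t | onEdge-preimage g
    -- Both `e` and `e₀` are mapped to `onEdge g e`, so applying the inverse `h` identifies them.
    ... | e₀ , s , j | h , hg , _ =
      subst (λ e → σ e ≡ true) (trans (sym (hg e₀)) (trans (cong h (sym (Joins-to e₀ j))) (hg e))) s
    forth : σ e ≡ true → τ (onEdge g e) ≡ true
    forth s = Equivalence.from (image (onEdge g e)) (e , s , onEdge-Joins-to e)

  pullback⇒image : ∀ {σ τ : Signature} → (∀ e → τ (onEdge g e) ≡ σ e) → ∀ e → (τ e ≡ true) ⇔ InImage ψ σ e
  pullback⇒image {σ} {τ} τ≡ e = mk⇔ forth back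
    where
    forth : τ e ≡ true → InImage ψ σ e
    forth t with onEdge-preimage g
    ... | h , _ , gh = h e , trans (sym (τ≡ (h e))) (trans (cong τ (gh e)) t) ,
      subst (λ e′ → Joins e′ _ _) (gh e) (onEdge-Joins-to (h e))
    back : InImage ψ σ e → τ e ≡ true
    back (e₀ , s , j) = trans (cong τ (Joins-to e₀ j)) (trans (τ≡ e₀) s)

~-pullback : ∀ g σ τ → (∀ e → τ (onEdge g e) ≡ σ e) → inv σ ~[ g ] inv τ
~-pullback g σ τ τ≡ =
  let sq≡ , p≡ = inv-cong {τ ∘ onEdge g} {σ} τ≡
      q , e    = inv-onEdge g τ
  in trans q (cong₂ (λ p s → p xor (exchanges g ∧ s)) p≡ (sum-cong-≗ sq≡)) ,
     λ i → trans (e i) (sq≡ i)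

SwitchIso⇒~ : ∀ σ₁ σ₂ → SwitchIso σ₁ σ₂ → inv σ₁ ~ inv σ₂
SwitchIso⇒~ σ₁ σ₂ (ψ , τ , image , switch) =
  let g , ψ≡g  = automorphisms ψ
      p≡ , sq≡ = ~-pullback g σ₁ τ (image⇒pullback g ψ ψ≡g {σ₁} {τ} image)
      f , q    = inv-switch switch
  in g , trans q p≡ , λ i → trans (f (face g i)) (sq≡ i)

-- The image `σ₁ ∘ h` and `σ₂` both have the invariant that `g` makes out of `inv σ₁`, hence they
-- are switching equivalent.
~⇒SwitchIso : ∀ σ₁ σ₂ → inv σ₁ ~ inv σ₂ → SwitchIso σ₁ σ₂
~⇒SwitchIso σ₁ σ₂ (g , e) =
  let h , hg , _ = onEdge-preimage g
      τ≡         = λ e → cong σ₁ (hg e)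
  in automorphism g , σ₁ ∘ h ,
     pullback⇒image g (automorphism g) (to-automorphism g) τ≡ ,
     ≈⇒SwitchEq (σ₁ ∘ h) σ₂
       (~[]-functional g (inv σ₁) (inv (σ₁ ∘ h)) (inv σ₂) (~-pullback g σ₁ (σ₁ ∘ h) τ≡) e)

-- The 27 classes.

rep-of : ∀ a → ∃ λ k → rep k ~ a
rep-of (x , p) =
  let k , g , q , e = rep-complete (tabulate x) p in
  k , g , q , λ i → trans (sym (lookup∘tabulate x (face g i))) (e i)

theorem9 : Σ (Signature → Fin 27) λ cls →
    (∀ k → ∃ λ σ → cls σ ≡ k) ×
    (∀ σ₁ σ₂ → (cls σ₁ ≡ cls σ₂) ⇔ SwitchIso σ₁ σ₂)
theorem9 = cls , surjective , λ σ₁ σ₂ → mk⇔ (same⇒iso σ₁ σ₂) (iso⇒same σ₁ σ₂)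
  where
  cls : Signature → Fin 27
  cls σ = proj₁ (rep-of (inv σ))

  rep~inv : ∀ σ → rep (cls σ) ~ inv σ
  rep~inv σ = proj₂ (rep-of (inv σ))

  surjective : ∀ k → ∃ λ σ → cls σ ≡ k
  -- The representative found for this signature lies in the orbit of `rep k`, so it can only be
  -- `rep k` itself.
  surjective k = realize (rep k) , rep-distinct (cls (realize (rep k))) k
    (~-respʳ (rep (cls (realize (rep k)))) (inv (realize (rep k))) (rep k)
      (rep~inv (realize (rep k))) (inv-realize (rep k)))

  same⇒iso : ∀ σ₁ σ₂ → cls σ₁ ≡ cls σ₂ → SwitchIso σ₁ σ₂
  same⇒iso σ₁ σ₂ same = ~⇒SwitchIso σ₁ σ₂
    (~-trans (~-sym (rep~inv σ₁)) (subst (λ k → rep k ~ inv σ₂) (sym same) (rep~inv σ₂)))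

  iso⇒same : ∀ σ₁ σ₂ → SwitchIso σ₁ σ₂ → cls σ₁ ≡ cls σ₂
  iso⇒same σ₁ σ₂ iso = rep-distinct (cls σ₁) (cls σ₂)
    (~-trans (rep~inv σ₁) (~-trans (SwitchIso⇒~ σ₁ σ₂ iso) (~-sym (rep~inv σ₂))))
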